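{- For every $k\ge 1$, there is a bijection between the set of $4\mathbb{Z}^k$-periodic cube tilings and the set of $k$-dimensional Unique Sink Orientations (USOs).
   Context: $4\mathbb{Z}^k$-periodic cube tiling: a tiling of the $k$-dimensional cube of side length $4$, with opposite sides identified (i.e. the torus $(\mathbb{R}/4\mathbb{Z})^k$), by $2^k$ axis-parallel, integer-grid aligned $k$-cubes (tiles) of side length $2$. A tile with lower-left corner $c\in\{0,1,2,3\}^k$ occupies the set $c+[0,2]^k$, taken componentwise modulo $4$; the tiles must cover the whole cube, and any point contained in several tiles lies on the boundary of all of them. A tiling is identified with the set of the $2^k$ corners of its tiles, a subset of $\{0,1,2,3\}^k$. USO: $Q_k$ is the $k$-dimensional hypercube graph with vertex set $\{0,1\}^k$, two vertices being adjacent if they differ in exactly one coordinate. A face is the subgraph induced by all vertices that agree with a fixed string $f\in\{0,1,*\}^k$ on the non-$*$ positions. An orientation of $Q_k$ assigns a direction to each edge; it is a Unique Sink Orientation (a $k$-dimensional USO) if every face contains exactly one vertex with no outgoing edges inside that face. -}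

module Defs where

open import Level using (0ℓ; suc)
open import Data.Bool using (Bool; true; false; not; T)
open import Data.Empty using (⊥)
open import Data.Fin using (Fin; toℕ)
open import Data.Integer as ℤ using (ℤ; +_)
open import Data.Maybe using (Maybe; just; nothing)
open import Data.Nat as ℕ using (ℕ)
open import Data.Product using (∃; ∃!; ∃-syntax; _×_; _,_)
open import Data.Rational using (ℚ; _/_; _<_)
open import Data.Sum using (_⊎_)
open import Data.Vec using (Vec; lookup)
open import Function using (_↔_; _⇔_)
open import Relation.Binary.Bundles using (Setoid)
open import Relation.Binary.PropositionalEquality using (_≡_; _≢_; refl; sym; trans)
open import Relation.Nullary using (¬_)

-- Real numbers as two-sided Dedekind cuts.
record ℝ : Set₁ where
  field
    Lower Upper     : ℚ → Set
    lower-inhabited : ∃ Lower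
    upper-inhabited : ∃ Upper
    lower-rounded   : ∀ q → Lower q ⇔ (∃[ r ] q < r × Lower r)
    upper-rounded   : ∀ q → Upper q ⇔ (∃[ r ] r < q × Upper r)
    disjoint        : ∀ q → Lower q → Upper q → ⊥
    located         : ∀ {q r} → q < r → Lower q ⊎ Upper r

open ℝ

_<ᴿ_ _≤ᴿ_ : ℤ → ℝ → Set
n <ᴿ x = Lower x (n / 1)
n ≤ᴿ x = ¬ Upper x (n / 1)

_ᴿ<_ _ᴿ≤_ : ℝ → ℤ → Set
x ᴿ< n = Upper x (n / 1)
x ᴿ≤ n = ¬ Lower x (n / 1)

-- A point of the torus (ℝ/4ℤ)ᵏ is given by any representative in ℝᵏ; every
-- predicate on points below is invariant under translation by 4ℤᵏ.
Point : ℕ → Set₁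
Point k = Vec ℝ k

Corner : ℕ → Set
Corner k = Vec (Fin 4) k

_+4·_ : Fin 4 → ℤ → ℤ
a +4· z = + toℕ a ℤ.+ + 4 ℤ.* z

_∈Tile_ : ∀ {k} → Point k → Corner k → Set
x ∈Tile c = ∀ i → ∃[ z ]
  (lookup c i +4· z) ≤ᴿ lookup x i × lookup x i ᴿ≤ ((lookup c i +4· z) ℤ.+ + 2)

_∈Interior_ : ∀ {k} → Point k → Corner k → Set
x ∈Interior c = ∀ i → ∃[ z ]
  (lookup c i +4· z) <ᴿ lookup x i × lookup x i ᴿ< ((lookup c i +4· z) ℤ.+ + 2)

_∈Boundary_ : ∀ {k} → Point k → Corner k → Set
x ∈Boundary c = x ∈Tile c × ¬ (x ∈Interior c)

-- Covering is stated with ¬¬, as one cannot decide constructively on which side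
-- of a shared facet a real point lies; classically the ¬¬ is redundant.
record Tiling (k : ℕ) : Set₁ where
  field
    corner : Corner k → Bool
    size   : Fin (2 ℕ.^ k) ↔ (∃[ c ] T (corner c))
    covers : ∀ (x : Point k) → ¬ ¬ (∃[ c ] T (corner c) × x ∈Tile c)
    meet   : ∀ (x : Point k) c d → T (corner c) → T (corner d) → c ≢ d →
             x ∈Tile c → x ∈Tile d → x ∈Boundary c × x ∈Boundary d

-- Tilings are compared as sets of corners.
Tilings : ℕ → Setoid (suc 0ℓ) 0ℓ
Tilings k = record
  { Carrier = Tiling k
  ; _≈_ = λ S S′ → ∀ c → Tiling.corner S c ≡ Tiling.corner S′ c
  ; isEquivalence = record
    { refl  = λ _ → refl
    ; sym   = λ p c → sym (p c)
    ; trans = λ p q c → trans (p c) (q c)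
    }
  }

Vertex : ℕ → Set
Vertex k = Vec Bool k

Adjacent : ∀ {k} → Vertex k → Vertex k → Set
Adjacent u v = ∃! _≡_ λ i → lookup u i ≢ lookup v i

-- T (arc u v) means that uv is an edge directed from u to v.
record Orientation (k : ℕ) : Set where
  field
    arc         : Vertex k → Vertex k → Bool
    arc-edge    : ∀ u v → T (arc u v) → Adjacent u v
    arc-reverse : ∀ u v → Adjacent u v → arc v u ≡ not (arc u v)

-- A string over {0,1,*}, with nothing for *.
Face : ℕ → Set
Face k = Vec (Maybe Bool) k

_∈Face_ : ∀ {k} → Vertex k → Face k → Set
v ∈Face f = ∀ i b → lookup f i ≡ just b → lookup v i ≡ b

IsSink : ∀ {k} → Orientation k → Face k → Vertex k → Set
IsSink O f v = v ∈Face f × (∀ w → w ∈Face f → ¬ T (Orientation.arc O v w))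

record USO (k : ℕ) : Set where
  field
    orientation : Orientation k
    unique-sink : ∀ (f : Face k) → ∃! _≡_ (IsSink orientation f)
  open Orientation orientation public

-- Orientations are compared by the directions of their edges.
USOs : ℕ → Setoid 0ℓ 0ℓ
USOs k = record
  { Carrier = USO k
  ; _≈_ = λ O O′ → ∀ u v → USO.arc O u v ≡ USO.arc O′ u v
  ; isEquivalence = record
    { refl  = λ _ _ → refl
    ; sym   = λ p u v → sym (p u v)
    ; trans = λ p q u v → trans (p u v) (q u v)
    }
  }

{-# OPTIONS --safe #-}

-- Code a residue modulo 4 by a position bit and an outgoing bit so that two
-- residues differ by 2 exactly if both bits differ.  Two tiles have disjoint
-- interiors iff some coordinates of their corners differ by 2, so a tiling is a
-- set of 2ᵏ pairs (u , t) of vertices, any two of which differ in both bits of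
-- a common coordinate.  By counting, this is the graph of a map s with
--   u ≠ v  ⇒  uᵢ ≠ vᵢ and s(u)ᵢ ≠ s(v)ᵢ for some i,
-- and by Szabó and Welzl these maps are the outmaps of the USOs, s(u)ᵢ telling
-- whether the edge at u along i is outgoing.
--
-- If s is such a map, then on every face the map from a vertex to its outgoing
-- bits inside the face is injective, hence surjective: there is a unique vertex
-- for every prescribed pattern of directions.  The all-incoming pattern gives
-- the unique sinks, and the other patterns give the covering of the torus by
-- the tiles, as a unit cube selects a face together with such a pattern.
-- Conversely, in a USO every pattern is attained exactly once on every face,
-- since reversing all edges along one coordinate preserves unique sinks.

module Submission where

open import Defs
open import Data.Nat using (ℕ; _≥_)
open import Function.Bundles using (Bijection)

open import Data.Bool using (Bool; true; false; not; T)
import Data.Bool.Properties as Bool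
open import Data.Fin using (Fin; zero; suc; toℕ; fromℕ<; punchOut)
open import Data.Fin.Patterns using (0F; 1F; 2F; 3F)
import Data.Fin.Properties as Fin
open import Data.Integer as ℤ using (ℤ; +_)
import Data.Integer.DivMod as ℤ
import Data.Integer.Properties as ℤ
open import Data.Integer.Tactic.RingSolver using (solve-∀)
open import Data.Maybe using (Maybe; just; nothing)
import Data.Nat as ℕ
import Data.Nat.Properties as ℕ
open import Data.Product using (∃; ∃!; ∃-syntax; _×_; _,_; proj₁; proj₂; uncurry)
open import Data.Product.Function.NonDependent.Propositional using (_×-↔_)
open import Data.Rational as ℚ using (ℚ; mkℚ; _/_; _<_; _<?_; 1ℚ)
import Data.Rational.Properties as ℚ
import Data.Rational.Unnormalised as ℚᵘ
import Data.Rational.Unnormalised.Properties as ℚᵘ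
open import Data.Sum using (_⊎_; inj₁; inj₂; [_,_]′) renaming (swap to ⊎-swap)
open import Data.Vec using (Vec; []; _∷_; lookup; map; zipWith; tabulate; updateAt; _[_]≔_)
import Data.Vec.Properties as Vec
open import Effect.Monad using (RawMonad)
open import Function using (_∘_; const; _↔_; mk↔ₛ′; Inverse; Equivalence; mk⇔; case_of_; Injective)
open import Function.Properties.Inverse using (Inverse⇒Bijection; ↔-trans)
open import Relation.Binary using (tri<; tri≈; tri>)
open import Relation.Binary.Bundles using (Setoid)
open import Relation.Binary.PropositionalEquality
  using (_≡_; _≢_; refl; sym; trans; cong; cong₂; subst; subst₂; module ≡-Reasoning)
open import Relation.Nullary using (¬_; Dec; yes; no; contradiction; from-yes; ¬¬-excluded-middle)
open import Relation.Nullary.Decidable using (toWitness; fromWitness; _×-dec_; isYes; True; decidable-stable)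
open import Relation.Nullary.Negation using (¬¬-map; ¬¬-Monad)

private
  variable
    k : ℕ
    A B : Set

-- Finite sets and vectors

injective⇒surjective : ∀ {n} → Fin n ↔ A → Fin n ↔ B → (f : A → B) →
                       Injective _≡_ _≡_ f → ∀ y → ∃[ x ] f x ≡ y
injective⇒surjective {A} {B} {n} finA finB f f-inj y =
  case Fin.any? (λ i → g i Fin.≟ y′) of λ where
    (yes (i , eq)) → ιA.to i , from-inj eq
    (no miss)      → contradiction (λ i eq → miss (i , sym eq)) (avoid g g-inj y′)
  where
  module ιA = Inverse finA
  module ιB = Inverse finB
  y′ = ιB.from y
  g  = ιB.from ∘ f ∘ ιA.to

  from-inj : ∀ {a b} → ιB.from a ≡ ιB.from b → a ≡ b
  from-inj {a} {b} eq =
    trans (sym (ιB.strictlyInverseˡ a)) (trans (cong ιB.to eq) (ιB.strictlyInverseˡ b))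

  g-inj : ∀ {i j} → g i ≡ g j → i ≡ j
  g-inj {i} {j} eq =
    trans (sym (ιA.strictlyInverseʳ i))
      (trans (cong ιA.from (f-inj (from-inj eq))) (ιA.strictlyInverseʳ j))

  -- Pigeonhole: if `p` is never hit, `punchOut` at `p` turns `h` into an injection of `Fin (suc m)`
  -- into `Fin m`.
  avoid : ∀ {m} (h : Fin m → Fin m) → (∀ {i j} → h i ≡ h j → i ≡ j) →
          (p : Fin m) → ¬ (∀ i → p ≢ h i)
  avoid {ℕ.suc m} h h-inj p p≢h =
    Fin.<⇒notInjective {f = λ i → punchOut (p≢h i)} (ℕ.n<1+n m)
      (λ {i} {j} eq → h-inj (Fin.punchOut-injective (p≢h i) (p≢h j) eq))

vertices : ∀ k → Fin (2 ℕ.^ k) ↔ Vertex k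
vertices ℕ.zero = mk↔ₛ′ (const []) (const zero) (λ { [] → refl }) (λ { zero → refl ; (suc ()) })
vertices (ℕ.suc k) = ↔-trans Fin.*↔× (↔-trans (Fin.2↔Bool ×-↔ vertices k)
  (mk↔ₛ′ (uncurry _∷_) (λ { (b ∷ v) → b , v }) (λ { (_ ∷ _) → refl }) (λ _ → refl)))

lookup-injective : {xs ys : Vec A k} → (∀ i → lookup xs i ≡ lookup ys i) → xs ≡ ys
lookup-injective {xs = xs} {ys} eq =
  trans (sym (Vec.tabulate∘lookup xs)) (trans (Vec.tabulate-cong eq) (Vec.tabulate∘lookup ys))

flip : Vertex k → Fin k → Vertex k
flip u i = updateAt u i not

flip-same : (u : Vertex k) (i : Fin k) → lookup (flip u i) i ≡ not (lookup u i)
flip-same u i = Vec.lookup∘updateAt i u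

flip-other : (u : Vertex k) {i j : Fin k} → j ≢ i → lookup (flip u i) j ≡ lookup u j
flip-other u {i} {j} j≢i = Vec.lookup∘updateAt′ j i j≢i u

≢flip : (u : Vertex k) (i : Fin k) → lookup u i ≢ lookup (flip u i) i
≢flip u i eq = Bool.not-¬ refl (trans eq (flip-same u i))

differs-at : (u : Vertex k) (i : Fin k) {j : Fin k} → lookup u j ≢ lookup (flip u i) j → i ≡ j
differs-at u i {j} ne = decidable-stable (i Fin.≟ j) λ i≢j → ne (sym (flip-other u (i≢j ∘ sym)))

adjacent-flip : (u : Vertex k) (i : Fin k) → Adjacent u (flip u i)
adjacent-flip u i = i , ≢flip u i , differs-at u i

Adjacent⇒flip : {u v : Vertex k} ((i , _) : Adjacent u v) → v ≡ flip u i
Adjacent⇒flip {u = u} {v} (i , ne , unique) = lookup-injective eq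
  where
  eq : ∀ j → lookup v j ≡ lookup (flip u i) j
  eq j with i Fin.≟ j
  ... | yes refl = trans (Bool.¬-not (ne ∘ sym)) (sym (flip-same u i))
  ... | no i≢j = trans (sym (decidable-stable (lookup u j Bool.≟ lookup v j) (i≢j ∘ unique)))
                       (sym (flip-other u (i≢j ∘ sym)))

flip-injective : (u : Vertex k) {i j : Fin k} → flip u i ≡ flip u j → i ≡ j
flip-injective u {i} {j} eq =
  sym (differs-at u j (subst (λ v → lookup u i ≢ lookup v i) eq (≢flip u i)))

flip-flip : (u : Vertex k) (i : Fin k) → flip (flip u i) i ≡ u
flip-flip u i = trans (Vec.updateAt-updateAt i u)
  (Vec.updateAt-id-local i u (Bool.not-involutive (lookup u i)))

-- Outmaps

OutMap : ℕ → Set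
OutMap k = Vertex k → Vertex k

-- Contrapositive of the condition in the overview: two vertices are shown equal by a check at each
-- coordinate, without a search for a separating one.
Separating : OutMap k → Set
Separating s = ∀ u v →
  (∀ i → lookup u i ≢ lookup v i → lookup (s u) i ≡ lookup (s v) i) → u ≡ v

-- A unit interval [n , n + 1] modulo 4.  The residues a for which [a , a + 2]
-- contains it are those with a prescribed position bit (n odd, inj₁) or a
-- prescribed outgoing bit (n even, inj₂) in the coding of residues below.
-- As a constraint on vertices, inj₁ fixes a coordinate, and inj₂ leaves it
-- free but prescribes the direction of the edge along it.
Slab : Set
Slab = Bool ⊎ Bool

Matches : Slab → Bool → Bool → Set
Matches (inj₁ b) p o = p ≡ b
Matches (inj₂ b) p o = o ≡ b

Fits : OutMap k → Vec Slab k → Vertex k → Set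
Fits s q u = ∀ i → Matches (lookup q i) (lookup u i) (lookup (s u) i)

UniqueFit : OutMap k → Vec Slab k → Set
UniqueFit s q = ∃! _≡_ (Fits s q)

-- `restrict` projects onto the face fixed by the `inj₁` entries. On those entries `φ` reads the
-- original vertex, elsewhere the outgoing bits of its projection. Keeping the forgotten coordinates
-- makes `φ` an injective self-map of the whole cube, so the counting happens there rather than on
-- the face; projecting a preimage of the target gives the fit.
separating⇒uniqueFit : (s : OutMap k) → Separating s → ∀ q → UniqueFit s q
separating⇒uniqueFit {k} s sep q = restrict u , fits , unique
  where
  restrictTo : Slab → Bool → Bool
  restrictTo (inj₁ b) _ = b
  restrictTo (inj₂ _) p = p

  restrict : Vertex k → Vertex k
  restrict u = zipWith restrictTo q u

  observe : Slab → Bool → Bool → Bool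
  observe (inj₁ _) p o = p
  observe (inj₂ _) p o = o

  target : Slab → Bool
  target (inj₁ b) = b
  target (inj₂ b) = b

  φ : Vertex k → Vertex k
  φ u = tabulate λ i → observe (lookup q i) (lookup u i) (lookup (s (restrict u)) i)

  φ-inj : Injective _≡_ _≡_ φ
  φ-inj {u} {v} eq = lookup-injective same
    where
    observed : ∀ i → observe (lookup q i) (lookup u i) (lookup (s (restrict u)) i)
                   ≡ observe (lookup q i) (lookup v i) (lookup (s (restrict v)) i)
    observed i = trans (sym (Vec.lookup∘tabulate _ i))
      (trans (cong (λ w → lookup w i) eq) (Vec.lookup∘tabulate _ i))

    restrict-eq : restrict u ≡ restrict v
    restrict-eq = sep _ _ agree
      where
      agree : ∀ i → lookup (restrict u) i ≢ lookup (restrict v) i →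
              lookup (s (restrict u)) i ≡ lookup (s (restrict v)) i
      agree i ne rewrite Vec.lookup-zipWith restrictTo i q u | Vec.lookup-zipWith restrictTo i q v
        with lookup q i | observed i
      ... | inj₁ b | _  = contradiction refl ne
      ... | inj₂ b | eq = eq

    restrict-eq′ : ∀ i → restrictTo (lookup q i) (lookup u i) ≡ restrictTo (lookup q i) (lookup v i)
    restrict-eq′ i = trans (sym (Vec.lookup-zipWith restrictTo i q u))
      (trans (cong (λ w → lookup w i) restrict-eq) (Vec.lookup-zipWith restrictTo i q v))

    same : ∀ i → lookup u i ≡ lookup v i
    same i with lookup q i | observed i | restrict-eq′ i
    ... | inj₁ b | eq | _  = eq
    ... | inj₂ b | _  | eq = eq

  hit : ∃[ u ] φ u ≡ map target q
  hit = injective⇒surjective (vertices k) (vertices k) φ φ-inj (map target q)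

  u = proj₁ hit

  fits : Fits s q (restrict u)
  fits i rewrite Vec.lookup-zipWith restrictTo i q u
    with lookup q i | trans (sym (Vec.lookup∘tabulate _ i))
           (trans (cong (λ w → lookup w i) (proj₂ hit)) (Vec.lookup-map i target q))
  ... | inj₁ b | _  = refl
  ... | inj₂ b | eq = eq

  unique : ∀ {v} → Fits s q v → restrict u ≡ v
  -- Two fits share a position bit or an outgoing bit in every coordinate, so no coordinate
  -- separates them.
  unique {v} fits′ = sep _ _ λ i → agree i (fits i) (fits′ i)
    where
    agree : ∀ i {p o p′ o′} → Matches (lookup q i) p o → Matches (lookup q i) p′ o′ →
            p ≢ p′ → o ≡ o′
    agree i m m′ ne with lookup q i
    ... | inj₁ b = contradiction (trans m (sym m′)) ne
    ... | inj₂ b = trans m (sym m′)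

-- The face spanned by u and v, with the outgoing bits of u prescribed, is
-- fitted by v as well if u and v are not separated.
uniqueFit⇒separating : (s : OutMap k) → (∀ q → UniqueFit s q) → Separating s
uniqueFit⇒separating {k} s uniqueFit u v agree =
  let _ , _ , unique = uniqueFit q in trans (sym (unique u-fits)) (unique v-fits)
  where
  slab : Fin k → Slab
  slab i with lookup u i Bool.≟ lookup v i
  ... | yes _ = inj₁ (lookup u i)
  ... | no  _ = inj₂ (lookup (s u) i)

  q = tabulate slab

  u-fits : Fits s q u
  u-fits i rewrite Vec.lookup∘tabulate slab i with lookup u i Bool.≟ lookup v i
  ... | yes _ = refl
  ... | no  _ = refl

  v-fits : Fits s q v
  v-fits i rewrite Vec.lookup∘tabulate slab i with lookup u i Bool.≟ lookup v i
  ... | yes eq = sym eq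
  ... | no  ne = sym (agree i ne)

-- Chosen so that the fits are the sinks of the face: every free edge must be incoming.
faceSlab : Maybe Bool → Slab
faceSlab (just b) = inj₁ b
faceSlab nothing  = inj₂ false

-- `inj₂ true` is the only slab outside the image of `faceSlab`, so outgoing demands can be
-- introduced one coordinate at a time.
slabs-induction : (P : Vec Slab k → Set) → (∀ f → P (map faceSlab f)) →
  (∀ q i → (∀ m → P (q [ i ]≔ faceSlab m)) → P (q [ i ]≔ inj₂ true)) → ∀ q → P q
slabs-induction P base step [] = base []
slabs-induction {ℕ.suc k} P base step (e ∷ q) = go e
  where
  faces : ∀ m → P (faceSlab m ∷ q)
  faces m = slabs-induction (P ∘ (faceSlab m ∷_)) (base ∘ (m ∷_))
    (λ q i → step (faceSlab m ∷ q) (suc i)) q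

  go : ∀ e → P (e ∷ q)
  go (inj₁ b)     = faces (just b)
  go (inj₂ false) = faces nothing
  go (inj₂ true)  = step (e ∷ q) zero faces

module _ (s : OutMap k) (q : Vec Slab k) (i : Fin k) where

  fits-at : ∀ {e u} → Fits s (q [ i ]≔ e) u → Matches e (lookup u i) (lookup (s u) i)
  fits-at {e} {u} fits =
    subst (λ e → Matches e (lookup u i) (lookup (s u) i)) (Vec.lookup∘update i q e) (fits i)

  refit : ∀ {e e′ u} → Fits s (q [ i ]≔ e) u → Matches e′ (lookup u i) (lookup (s u) i) →
          Fits s (q [ i ]≔ e′) u
  refit {e} {e′} {u} fits m j with j Fin.≟ i
  ... | yes refl = subst (λ e → Matches e (lookup u i) (lookup (s u) i))
                     (sym (Vec.lookup∘update i q e′)) m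
  ... | no j≢i = subst (λ e → Matches e (lookup u j) (lookup (s u) j))
                   (trans (Vec.lookup∘update′ j≢i q e) (sym (Vec.lookup∘update′ j≢i q e′))) (fits j)

  -- The facet whose fit is not the fit of the whole face provides the fit of
  -- the face after reversing the prescribed direction along i.
  reverse-direction : (∀ m → UniqueFit s (q [ i ]≔ faceSlab m)) → UniqueFit s (q [ i ]≔ inj₂ true)
  reverse-direction uniqueFit = v , refit v-fits v-out , unique
    where
    w = proj₁ (uniqueFit nothing)
    w-fits = proj₁ (proj₂ (uniqueFit nothing))
    w-unique = proj₂ (proj₂ (uniqueFit nothing))
    c = not (lookup w i)
    v = proj₁ (uniqueFit (just c))
    v-fits = proj₁ (proj₂ (uniqueFit (just c)))

    v-out : lookup (s v) i ≡ true
    v-out = Bool.¬-not λ out≡false →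
      Bool.not-¬ refl
        (trans (cong (λ x → lookup x i) (w-unique (refit v-fits out≡false))) (fits-at v-fits))

    unique : ∀ {x} → Fits s (q [ i ]≔ inj₂ true) x → v ≡ x
    -- A rival in the facet of `v` is `v` by uniqueness there; a rival in the facet of `w` would be
    -- `w`, whose edge along `i` is incoming.
    unique {x} x-fits with lookup x i Bool.≟ c
    ... | yes eq = proj₂ (proj₂ (uniqueFit (just c))) (refit x-fits eq)
    ... | no  ne = contradiction
      (trans (sym (fits-at w-fits)) (trans (cong (λ y → lookup (s y) i) w≡x) (fits-at x-fits))) λ ()
      where
      x≡w : lookup x i ≡ lookup w i
      x≡w = trans (Bool.¬-not ne) (Bool.not-involutive _)
      facet = uniqueFit (just (lookup w i))
      w≡x : w ≡ x
      w≡x = trans (sym (proj₂ (proj₂ facet) (refit w-fits refl))) (proj₂ (proj₂ facet) (refit x-fits x≡w))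

faceFits⇒separating : (s : OutMap k) → (∀ f → UniqueFit s (map faceSlab f)) → Separating s
faceFits⇒separating s faces =
  uniqueFit⇒separating s (slabs-induction (UniqueFit s) faces (reverse-direction s))

-- Orientations and outmaps

outMap : Orientation k → OutMap k
outMap O u = tabulate λ i → Orientation.arc O u (flip u i)

Arc : OutMap k → Vertex k → Vertex k → Set
Arc s u v = ∃[ i ] v ≡ flip u i × lookup (s u) i ≡ true

arc? : (s : OutMap k) → ∀ u v → Dec (Arc s u v)
arc? s u v = Fin.any? λ i →
  Vec.≡-dec Bool._≟_ v (flip u i) ×-dec (lookup (s u) i Bool.≟ true)

isYes-arc?-flip : (s : OutMap k) → ∀ u i → isYes (arc? s u (flip u i)) ≡ lookup (s u) i
isYes-arc?-flip s u i with arc? s u (flip u i)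
... | yes (j , eq , out) rewrite flip-injective u eq = sym out
... | no ¬arc = sym (Bool.¬-not λ out → ¬arc (i , refl , out))

orientation : (s : OutMap k) → Separating s → Orientation k
orientation s sep = record
  { arc         = λ u v → isYes (arc? s u v)
  ; arc-edge    = λ u v t → edge (toWitness t)
  ; arc-reverse = λ u v adj → reverse u v adj
  }
  where
  edge : ∀ {u v} → Arc s u v → Adjacent u v
  edge {u} (i , refl , _) = adjacent-flip u i

  -- Adjacent vertices differ only at `i`, so if their outgoing bits agreed there, separation would
  -- identify them.
  reverse : ∀ u v → Adjacent u v → isYes (arc? s v u) ≡ not (isYes (arc? s u v))
  reverse u v adj@(i , _) with refl ← Adjacent⇒flip {u = u} {v} adj = begin
    isYes (arc? s v u)           ≡⟨ cong (isYes ∘ arc? s v) (flip-flip u i) ⟨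
    isYes (arc? s v (flip v i))  ≡⟨ isYes-arc?-flip s v i ⟩
    lookup (s v) i               ≡⟨ Bool.¬-not (λ eq → ≢flip u i (uᵢ≡vᵢ eq)) ⟩
    not (lookup (s u) i)         ≡⟨ cong not (isYes-arc?-flip s u i) ⟨
    not (isYes (arc? s u v))     ∎
    where
    open ≡-Reasoning
    agree : lookup (s v) i ≡ lookup (s u) i →
            ∀ j → lookup u j ≢ lookup v j → lookup (s u) j ≡ lookup (s v) j
    agree eq j ne with refl ← differs-at u i ne = sym eq

    uᵢ≡vᵢ : lookup (s v) i ≡ lookup (s u) i → lookup u i ≡ lookup v i
    uᵢ≡vᵢ eq = cong (λ w → lookup w i) (sep u v (agree eq))

outMap-orientation : (s : OutMap k) (sep : Separating s) → ∀ u → outMap (orientation s sep) u ≡ s u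
outMap-orientation s sep u = lookup-injective λ i →
  trans (Vec.lookup∘tabulate _ i) (isYes-arc?-flip s u i)

module _ (O : Orientation k) where
  open Orientation O

  -- The outmap determines the orientation, as `arc-edge` confines arcs to pairs `u`, `flip u i`.
  arc≡isYes-arc? : ∀ u v → arc u v ≡ isYes (arc? (outMap O) u v)
  arc≡isYes-arc? u v with arc? (outMap O) u v
  ... | yes (i , refl , out) = trans (sym (Vec.lookup∘tabulate _ i)) out
  ... | no ¬arc = Bool.¬-not λ eq →
    let i , _ = arc-edge u v (Equivalence.from Bool.T-≡ eq)
        v≡flip = Adjacent⇒flip (arc-edge u v (Equivalence.from Bool.T-≡ eq))
    in ¬arc (i , v≡flip , trans (Vec.lookup∘tabulate _ i) (trans (cong (arc u) (sym v≡flip)) eq))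

  -- Flipping a free coordinate stays inside the face, so a sink has no arc along it.
  sink⇒fits : ∀ f {v} → IsSink O f v → Fits (outMap O) (map faceSlab f) v
  sink⇒fits f {v} (v∈f , no-arc) i rewrite Vec.lookup-map i faceSlab f with lookup f i in fᵢ
  ... | just b  = v∈f i b fᵢ
  ... | nothing = trans (Vec.lookup∘tabulate _ i)
    (Bool.¬-not (no-arc (flip v i) flip∈f ∘ Equivalence.from Bool.T-≡))
    where
    flip∈f : flip v i ∈Face f
    flip∈f j b fⱼ with j Fin.≟ i
    ... | yes refl = contradiction (trans (sym fᵢ) fⱼ) λ ()
    ... | no j≢i   = trans (flip-other v j≢i) (v∈f j b fⱼ)

  fits⇒sink : ∀ f {v} → Fits (outMap O) (map faceSlab f) v → IsSink O f v
  fits⇒sink f {v} fits = v∈f , no-arc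
    where
    fits′ : ∀ i → Matches (faceSlab (lookup f i)) (lookup v i) (lookup (outMap O v) i)
    fits′ i = subst (λ e → Matches e (lookup v i) (lookup (outMap O v) i))
      (Vec.lookup-map i faceSlab f) (fits i)

    v∈f : v ∈Face f
    v∈f i b fᵢ = subst (λ m → Matches (faceSlab m) (lookup v i) (lookup (outMap O v) i)) fᵢ (fits′ i)

    no-arc : ∀ w → w ∈Face f → ¬ T (arc v w)
    -- An arc along a fixed coordinate would leave the face; along a free one it contradicts the
    -- incoming bit.
    no-arc w w∈f t with i , ne , _ ← arc-edge v w t | refl ← Adjacent⇒flip {u = v} {w} (arc-edge v w t)
      with lookup f i in fᵢ | fits′ i
    ... | just b  | v≡b = ne (trans v≡b (sym (w∈f i b fᵢ)))
    ... | nothing | out≡false = subst T (trans (sym (Vec.lookup∘tabulate _ i)) out≡false) t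

outMap-separating : (O : USO k) → Separating (outMap (USO.orientation O))
outMap-separating O = faceFits⇒separating (outMap (USO.orientation O)) λ f →
  let v , sink , unique = USO.unique-sink O f
  in v , sink⇒fits (USO.orientation O) f sink , λ fits → unique (fits⇒sink (USO.orientation O) f fits)

separating⇒USO : (s : OutMap k) → Separating s → USO k
separating⇒USO s sep = record
  { orientation = O
  ; unique-sink = λ f →
      let v , fits , unique = separating⇒uniqueFit (outMap O) sep′ (map faceSlab f)
      in v , fits⇒sink O f fits , λ sink → unique (sink⇒fits O f sink)
  }
  where
  O = orientation s sep
  -- `outMap O` equals `s` only pointwise, so separation has to be transported.
  sep′ : Separating (outMap O)
  sep′ u v agree = sep u v λ i ne →
    subst₂ (λ x y → lookup x i ≡ lookup y i)
      (outMap-orientation s sep u) (outMap-orientation s sep v) (agree i ne)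

-- Real numbers

module _ (x : ℝ) where
  open ℝ x

  Lower-mono : ∀ {p q} → p ℚ.≤ q → Lower q → Lower p
  Lower-mono {p} {q} p≤q l =
    let r , q<r , l′ = Equivalence.to (lower-rounded q) l
    in Equivalence.from (lower-rounded p) (r , ℚ.≤-<-trans p≤q q<r , l′)

  Upper-mono : ∀ {p q} → p ℚ.≤ q → Upper p → Upper q
  Upper-mono {p} {q} p≤q u =
    let r , r<p , u′ = Equivalence.to (upper-rounded p) u
    in Equivalence.from (upper-rounded q) (r , ℚ.<-≤-trans r<p p≤q , u′)

-- `_/_` does not compute on a variable numerator, hence the detour through unnormalised rationals.
/1-mono : ∀ {m n} → m ℤ.≤ n → m / 1 ℚ.≤ n / 1
/1-mono {m} {n} m≤n = ℚ.toℚᵘ-cancel-≤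
  (ℚᵘ.≤-respˡ-≃ (ℚᵘ.≃-sym (ℚ.toℚᵘ-fromℚᵘ (ℚᵘ.mkℚᵘ m 0)))
    (ℚᵘ.≤-respʳ-≃ (ℚᵘ.≃-sym (ℚ.toℚᵘ-fromℚᵘ (ℚᵘ.mkℚᵘ n 0)))
      (ℚᵘ.*≤* (ℤ.*-monoʳ-≤-nonNeg (+ 1) m≤n))))

real : ℚ → ℝ
real q = record
  { Lower = _< q
  ; Upper = q <_
  ; lower-inhabited = q ℚ.- 1ℚ ,
      subst (q ℚ.- 1ℚ <_) (ℚ.+-identityʳ q) (ℚ.+-monoʳ-< q (from-yes (ℚ.- 1ℚ <? ℚ.0ℚ)))
  ; upper-inhabited = q ℚ.+ 1ℚ ,
      subst (_< q ℚ.+ 1ℚ) (ℚ.+-identityʳ q) (ℚ.+-monoʳ-< q (from-yes (ℚ.0ℚ <? 1ℚ)))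
  ; lower-rounded = λ p → mk⇔ ℚ.<-dense λ (r , p<r , r<q) → ℚ.<-trans p<r r<q
  ; upper-rounded = λ p → mk⇔ (λ q<p → let r , q<r , r<p = ℚ.<-dense q<p in r , r<p , q<r)
                              λ (r , r<p , q<r) → ℚ.<-trans q<r r<p
  ; disjoint = λ p p<q q<p → ℚ.<-asym p<q q<p
  ; located = λ {p} {r} p<r → locate p r p<r
  }
  where
  locate : ∀ p r → p < r → p < q ⊎ q < r
  locate p r p<r with ℚ.<-cmp p q
  ... | tri< p<q _ _  = inj₁ p<q
  ... | tri≈ _ refl _ = inj₂ p<r
  ... | tri> _ _ q<p  = inj₂ (ℚ.<-trans q<p p<r)

<ᴿ-mono : ∀ x m n → m ℤ.≤ n → n <ᴿ x → m <ᴿ x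
<ᴿ-mono x m n m≤n = Lower-mono x (/1-mono {m} {n} m≤n)

ᴿ<-mono : ∀ x m n → m ℤ.≤ n → x ᴿ< m → x ᴿ< n
ᴿ<-mono x m n m≤n = Upper-mono x (/1-mono {m} {n} m≤n)

<ᴿ⇒≤ᴿ : ∀ n x → n <ᴿ x → n ≤ᴿ x
<ᴿ⇒≤ᴿ n x l u = ℝ.disjoint x (n / 1) l u

ᴿ<⇒ᴿ≤ : ∀ n x → x ᴿ< n → x ᴿ≤ n
ᴿ<⇒ᴿ≤ n x u l = ℝ.disjoint x (n / 1) l u

-- The denominator is at least 1, so the numerator already bounds the fraction. This crude integer
-- bound starts and ends the search in `unit-interval`.
∣p∣-bounds : ∀ p → ℤ.- + ℤ.∣ ℚ.↥ p ∣ / 1 ℚ.≤ p × p ℚ.≤ + ℤ.∣ ℚ.↥ p ∣ / 1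
∣p∣-bounds p@(mkℚ n d-1 _) = lower , upper
  where
  ∣n∣≤ : + ℤ.∣ n ∣ ℤ.≤ + ℤ.∣ n ∣ ℤ.* + ℕ.suc d-1
  ∣n∣≤ = subst (+ ℤ.∣ n ∣ ℤ.≤_) (ℤ.pos-* ℤ.∣ n ∣ (ℕ.suc d-1)) (ℤ.+≤+ (ℕ.m≤m*n ℤ.∣ n ∣ (ℕ.suc d-1)))

  n≤∣n∣ : ∀ n → n ℤ.≤ + ℤ.∣ n ∣
  n≤∣n∣ (+ n) = ℤ.≤-refl
  n≤∣n∣ (ℤ.-[1+ n ]) = ℤ.-≤+

  -∣n∣≤n : ∀ n → ℤ.- + ℤ.∣ n ∣ ℤ.≤ n
  -∣n∣≤n (+ n) = ℤ.neg-≤-pos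
  -∣n∣≤n (ℤ.-[1+ n ]) = ℤ.≤-refl

  open ℤ.≤-Reasoning

  lower : ℤ.- + ℤ.∣ n ∣ / 1 ℚ.≤ p
  lower = ℚ.toℚᵘ-cancel-≤ (ℚᵘ.≤-respˡ-≃ (ℚᵘ.≃-sym (ℚ.toℚᵘ-fromℚᵘ (ℚᵘ.mkℚᵘ (ℤ.- + ℤ.∣ n ∣) 0)))
    (ℚᵘ.*≤* (begin
      ℤ.- + ℤ.∣ n ∣ ℤ.* + ℕ.suc d-1    ≡⟨ ℤ.neg-distribˡ-* (+ ℤ.∣ n ∣) (+ ℕ.suc d-1) ⟨
      ℤ.- (+ ℤ.∣ n ∣ ℤ.* + ℕ.suc d-1)  ≤⟨ ℤ.neg-mono-≤ ∣n∣≤ ⟩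
      ℤ.- + ℤ.∣ n ∣                    ≤⟨ -∣n∣≤n n ⟩
      n                                ≡⟨ ℤ.*-identityʳ n ⟨
      n ℤ.* + 1                        ∎)))

  upper : p ℚ.≤ + ℤ.∣ n ∣ / 1
  upper = ℚ.toℚᵘ-cancel-≤ (ℚᵘ.≤-respʳ-≃ (ℚᵘ.≃-sym (ℚ.toℚᵘ-fromℚᵘ (ℚᵘ.mkℚᵘ (+ ℤ.∣ n ∣) 0)))
    (ℚᵘ.*≤* (begin
      n ℤ.* + 1                    ≡⟨ ℤ.*-identityʳ n ⟩
      n                            ≤⟨ n≤∣n∣ n ⟩
      + ℤ.∣ n ∣                    ≤⟨ ∣n∣≤ ⟩
      + ℤ.∣ n ∣ ℤ.* + ℕ.suc d-1    ∎)))

-- Climb from an integer below `x` towards one above it until the next integer exceeds `x`. A cut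
-- does not decide these comparisons, so each is made under double negation.
unit-interval : ∀ x → ¬ ¬ (∃[ n ] n ≤ᴿ x × x ᴿ≤ (n ℤ.+ + 1))
unit-interval x = ascend (a ℕ.+ b) (ℤ.- + a) a≤x
  (subst (x ᴿ<_) (cancel (+ a) (+ b)) x<b)
  where
  p = proj₁ (ℝ.lower-inhabited x)
  q = proj₁ (ℝ.upper-inhabited x)
  a = ℤ.∣ ℚ.↥ p ∣
  b = ℤ.∣ ℚ.↥ q ∣

  cancel : ∀ m n → n ≡ ℤ.- m ℤ.+ (m ℤ.+ n)
  cancel = solve-∀

  a≤x : (ℤ.- + a) ≤ᴿ x
  a≤x = <ᴿ⇒≤ᴿ (ℤ.- + a) x (Lower-mono x (proj₁ (∣p∣-bounds p)) (proj₂ (ℝ.lower-inhabited x)))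

  x<b : x ᴿ< (+ b)
  x<b = Upper-mono x (proj₂ (∣p∣-bounds q)) (proj₂ (ℝ.upper-inhabited x))

  +-shift : ∀ m N → m ℤ.+ (+ 1 ℤ.+ N) ≡ (m ℤ.+ + 1) ℤ.+ N
  +-shift = solve-∀

  ascend : ∀ N m → m ≤ᴿ x → x ᴿ< (m ℤ.+ + N) → ¬ ¬ (∃[ n ] n ≤ᴿ x × x ᴿ≤ (n ℤ.+ + 1))
  ascend ℕ.zero m m≤x x<m _ = m≤x (subst (x ᴿ<_) (ℤ.+-identityʳ m) x<m)
  ascend (ℕ.suc N) m m≤x x<m+N none = ¬¬-excluded-middle λ where
    (yes x<m+1) → none (m , m≤x , ᴿ<⇒ᴿ≤ (m ℤ.+ + 1) x x<m+1)
    -- The refutation of `x ᴿ< (m + 1)` is by definition the lower bound for the next round.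
    (no m+1≤x)  → ascend N (m ℤ.+ + 1) m+1≤x (subst (x ᴿ<_) (+-shift m (+ N)) x<m+N) none

-- Tiles

-- A cyclic Gray code: a step by 1 changes one bit, a step by 2 both. Consecutive residues thus
-- share exactly one bit, which names the unit interval common to their sides.
position outgoing : Fin 4 → Bool
position 0F = false
position 1F = false
position 2F = true
position 3F = true
outgoing 0F = false
outgoing 1F = true
outgoing 2F = true
outgoing 3F = false

residue : Bool → Bool → Fin 4
residue false false = 0F
residue false true  = 1F
residue true  true  = 2F
residue true  false = 3F

-- The sides of the consecutive residues n - 1 and n meet in [n , n + 1]; the level is this n.
level : Slab → Fin 4
level (inj₁ false) = 1F
level (inj₁ true)  = 3F
level (inj₂ false) = 0F
level (inj₂ true)  = 2F

SlabOf : Fin 4 → Slab → Set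
SlabOf a e = Matches e (position a) (outgoing a)

InSlab : ℝ → Slab → Set
InSlab x e = ∃[ z ] (level e +4· z) ≤ᴿ x × x ᴿ≤ ((level e +4· z) ℤ.+ + 1)

InSide InOpenSide : ℝ → Fin 4 → Set
InSide x a = ∃[ z ] (a +4· z) ≤ᴿ x × x ᴿ≤ ((a +4· z) ℤ.+ + 2)
InOpenSide x a = ∃[ z ] (a +4· z) <ᴿ x × x ᴿ< ((a +4· z) ℤ.+ + 2)

InOpenSide⇒InSide : ∀ x {a} → InOpenSide x a → InSide x a
InOpenSide⇒InSide x {a} (z , l , u) = z , <ᴿ⇒≤ᴿ (a +4· z) x l , ᴿ<⇒ᴿ≤ ((a +4· z) ℤ.+ + 2) x u

-- The midpoint `level e` + 1/2, which avoids all integers and hence all tile boundaries.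
centre : Slab → ℝ
centre e = real ((+ (1 ℕ.+ 2 ℕ.* toℕ (level e))) / 2)

centre-inside : ∀ e a → SlabOf a e → InOpenSide (centre e) a
centre-inside = λ where
    (inj₁ false) 0F _ → inside (inj₁ false) 0F (+ 0)
    (inj₁ false) 1F _ → inside (inj₁ false) 1F (+ 0)
    (inj₁ true)  2F _ → inside (inj₁ true) 2F (+ 0)
    (inj₁ true)  3F _ → inside (inj₁ true) 3F (+ 0)
    (inj₂ false) 0F _ → inside (inj₂ false) 0F (+ 0)
    -- The side from 3 wraps around; its translate [-1 , 1] contains the centre 1/2.
    (inj₂ false) 3F _ → inside (inj₂ false) 3F (ℤ.- + 1)
    (inj₂ true)  1F _ → inside (inj₂ true) 1F (+ 0)
    (inj₂ true)  2F _ → inside (inj₂ true) 2F (+ 0)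
    (inj₁ false) 2F ()
    (inj₁ false) 3F ()
    (inj₁ true)  0F ()
    (inj₁ true)  1F ()
    (inj₂ false) 1F ()
    (inj₂ false) 2F ()
    (inj₂ true)  0F ()
    (inj₂ true)  3F ()
  where
  inside : ∀ e a z (let q = (+ (1 ℕ.+ 2 ℕ.* toℕ (level e))) / 2)
           {_ : True ((a +4· z) / 1 <? q)} {_ : True (q <? ((a +4· z) ℤ.+ + 2) / 1)} →
           InOpenSide (centre e) a
  inside _ _ z {l} {u} = z , toWitness l , toWitness u

-- The unit interval is the lower half of the side if `a` is the level, and the upper half if `a`
-- precedes it cyclically.
InSlab⇒InSide : ∀ x e a → SlabOf a e → InSlab x e → InSide x a
InSlab⇒InSide x = λ where
    (inj₁ false) 0F _ (z , s) → z , upper-half (0F +4· z) (1F +4· z) (0→1 z) s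
    (inj₁ false) 1F _ (z , s) → z , lower-half (1F +4· z) s
    (inj₁ true)  2F _ (z , s) → z , upper-half (2F +4· z) (3F +4· z) (2→3 z) s
    (inj₁ true)  3F _ (z , s) → z , lower-half (3F +4· z) s
    (inj₂ false) 0F _ (z , s) → z , lower-half (0F +4· z) s
    (inj₂ false) 3F _ (z , s) → z ℤ.- + 1 , upper-half (3F +4· (z ℤ.- + 1)) (0F +4· z) (3→4 z) s
    (inj₂ true)  1F _ (z , s) → z , upper-half (1F +4· z) (2F +4· z) (1→2 z) s
    (inj₂ true)  2F _ (z , s) → z , lower-half (2F +4· z) s
    (inj₁ false) 2F ()
    (inj₁ false) 3F ()
    (inj₁ true)  0F ()
    (inj₁ true)  1F ()
    (inj₂ false) 1F ()
    (inj₂ false) 2F ()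
    (inj₂ true)  0F ()
    (inj₂ true)  3F ()
  where
  In[_,_+_] : ℝ → ℤ → ℤ → Set
  In[ x , n + d ] = n ≤ᴿ x × x ᴿ≤ (n ℤ.+ d)

  lower-half : ∀ n → In[ x , n + + 1 ] → In[ x , n + + 2 ]
  lower-half n (l , u) =
    l , u ∘ <ᴿ-mono x (n ℤ.+ + 1) (n ℤ.+ + 2) (ℤ.+-monoʳ-≤ n (ℤ.+≤+ (ℕ.s≤s ℕ.z≤n)))

  upper-half : ∀ m n → n ≡ m ℤ.+ + 1 → In[ x , n + + 1 ] → In[ x , m + + 2 ]
  upper-half m n refl (l , u) =
    l ∘ ᴿ<-mono x m (m ℤ.+ + 1) (ℤ.i≤i+j m (+ 1)) ,
    subst (x ᴿ≤_) (ℤ.+-assoc m (+ 1) (+ 1)) u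

  0→1 : ∀ z → + 1 ℤ.+ + 4 ℤ.* z ≡ (+ 0 ℤ.+ + 4 ℤ.* z) ℤ.+ + 1
  0→1 = solve-∀
  1→2 : ∀ z → + 2 ℤ.+ + 4 ℤ.* z ≡ (+ 1 ℤ.+ + 4 ℤ.* z) ℤ.+ + 1
  1→2 = solve-∀
  2→3 : ∀ z → + 3 ℤ.+ + 4 ℤ.* z ≡ (+ 2 ℤ.+ + 4 ℤ.* z) ℤ.+ + 1
  2→3 = solve-∀
  3→4 : ∀ z → + 0 ℤ.+ + 4 ℤ.* z ≡ (+ 3 ℤ.+ + 4 ℤ.* (z ℤ.- + 1)) ℤ.+ + 1
  3→4 = solve-∀

some-slab : ∀ x → ¬ ¬ (∃ (InSlab x))
some-slab x = ¬¬-map (λ (n , l , u) → classify n l u) (unit-interval x)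
  where
  slab-at : ∀ r → ∃[ e ] toℕ (level e) ≡ toℕ r
  slab-at 0F = inj₂ false , refl
  slab-at 1F = inj₁ false , refl
  slab-at 2F = inj₂ true  , refl
  slab-at 3F = inj₁ true  , refl

  classify : ∀ n → n ≤ᴿ x → x ᴿ≤ (n ℤ.+ + 1) → ∃ (InSlab x)
  classify n l u = e , z , subst (λ m → m ≤ᴿ x × x ᴿ≤ (m ℤ.+ + 1)) n≡ (l , u)
    where
    z = n ℤ./ℕ 4
    r = fromℕ< (ℤ.n%ℕd<d n 4)
    e = proj₁ (slab-at r)
    n≡ : n ≡ level e +4· z
    n≡ = trans (ℤ.a≡a%ℕn+[a/ℕn]*n n 4) (cong₂ ℤ._+_
      (cong +_ (sym (trans (proj₂ (slab-at r)) (Fin.toℕ-fromℕ< _)))) (ℤ.*-comm z (+ 4)))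

-- Residues with both bits different are 2 apart, so the starting points of the two sides differ by
-- an odd multiple of 2, hence by at least their length.
opposite-apart : ∀ a b → position a ≢ position b → outgoing a ≢ outgoing b → ∀ y z →
  (a +4· y) ℤ.+ + 2 ℤ.≤ (b +4· z) ⊎ (b +4· z) ℤ.+ + 2 ℤ.≤ (a +4· y)
opposite-apart = λ where
    0F 2F _ _ y z → apart (+ 0) y z
    1F 3F _ _ y z → apart (+ 1) y z
    2F 0F _ _ y z → ⊎-swap (apart (+ 0) z y)
    3F 1F _ _ y z → ⊎-swap (apart (+ 1) z y)
    0F 0F p _ → contradiction refl p
    0F 1F p _ → contradiction refl p
    0F 3F _ o → contradiction refl o
    1F 0F p _ → contradiction refl p
    1F 1F p _ → contradiction refl p
    1F 2F _ o → contradiction refl o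
    2F 1F _ o → contradiction refl o
    2F 2F p _ → contradiction refl p
    2F 3F p _ → contradiction refl p
    3F 0F _ o → contradiction refl o
    3F 2F p _ → contradiction refl p
    3F 3F p _ → contradiction refl p
  where
  apart : ∀ n y z → (n ℤ.+ + 4 ℤ.* y) ℤ.+ + 2 ℤ.≤ (+ 2 ℤ.+ n) ℤ.+ + 4 ℤ.* z
                  ⊎ ((+ 2 ℤ.+ n) ℤ.+ + 4 ℤ.* z) ℤ.+ + 2 ℤ.≤ n ℤ.+ + 4 ℤ.* y
  apart n y z with y ℤ.≤? z
  ... | yes y≤z = inj₁ (subst (ℤ._≤ (+ 2 ℤ.+ n) ℤ.+ + 4 ℤ.* z) (sym (eq n y))
                    (ℤ.+-monoʳ-≤ (+ 2 ℤ.+ n) (ℤ.*-monoˡ-≤-nonNeg (+ 4) y≤z)))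
    where
    eq : ∀ n y → (n ℤ.+ + 4 ℤ.* y) ℤ.+ + 2 ≡ (+ 2 ℤ.+ n) ℤ.+ + 4 ℤ.* y
    eq = solve-∀
  ... | no y≰z = inj₂ (subst (ℤ._≤ n ℤ.+ + 4 ℤ.* y) (sym (eq n z))
                   (ℤ.+-monoʳ-≤ n (ℤ.*-monoˡ-≤-nonNeg (+ 4) (ℤ.i<j⇒suc[i]≤j (ℤ.≰⇒> y≰z)))))
    where
    eq : ∀ n z → ((+ 2 ℤ.+ n) ℤ.+ + 4 ℤ.* z) ℤ.+ + 2 ≡ n ℤ.+ + 4 ℤ.* (+ 1 ℤ.+ z)
    eq = solve-∀

-- A point strictly inside one side cannot even touch the end of a side lying apart from it.
InOpenSide-InSide⇒agree : ∀ x a b → InOpenSide x a → InSide x b →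
  position a ≢ position b → outgoing a ≡ outgoing b
InOpenSide-InSide⇒agree x a b (y , l , u) (z , l′ , u′) p =
  decidable-stable (outgoing a Bool.≟ outgoing b) λ o →
    [ (λ below → l′ (ᴿ<-mono x ((a +4· y) ℤ.+ + 2) (b +4· z) below u))
    , (λ above → u′ (<ᴿ-mono x ((b +4· z) ℤ.+ + 2) (a +4· y) above l)) ]′ (opposite-apart a b p o y z)

-- The shared bit serves as the slab; collected over all coordinates, these slabs form a unit cube
-- inside both tiles.
common-slab : ∀ a b → (position a ≢ position b → outgoing a ≡ outgoing b) →
  ∃[ e ] SlabOf a e × SlabOf b e
common-slab a b agree with position a Bool.≟ position b
... | yes eq = inj₁ (position b) , eq , refl
... | no ne  = inj₂ (outgoing b) , agree ne , refl

-- Corners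

residue-position-outgoing : ∀ a → residue (position a) (outgoing a) ≡ a
residue-position-outgoing 0F = refl
residue-position-outgoing 1F = refl
residue-position-outgoing 2F = refl
residue-position-outgoing 3F = refl

position-residue : ∀ p o → position (residue p o) ≡ p
position-residue false false = refl
position-residue false true  = refl
position-residue true  true  = refl
position-residue true  false = refl

outgoing-residue : ∀ p o → outgoing (residue p o) ≡ o
outgoing-residue false false = refl
outgoing-residue false true  = refl
outgoing-residue true  true  = refl
outgoing-residue true  false = refl

positions outgoings : Corner k → Vertex k
positions = map position
outgoings = map outgoing

fromBits : Vertex k → Vertex k → Corner k
fromBits = zipWith residue

fromBits-positions-outgoings : (c : Corner k) → fromBits (positions c) (outgoings c) ≡ c
fromBits-positions-outgoings []      = refl
fromBits-positions-outgoings (a ∷ c) =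
  cong₂ _∷_ (residue-position-outgoing a) (fromBits-positions-outgoings c)

positions-fromBits : (u t : Vertex k) → positions (fromBits u t) ≡ u
positions-fromBits []      []      = refl
positions-fromBits (p ∷ u) (o ∷ t) = cong₂ _∷_ (position-residue p o) (positions-fromBits u t)

outgoings-fromBits : (u t : Vertex k) → outgoings (fromBits u t) ≡ t
outgoings-fromBits []      []      = refl
outgoings-fromBits (p ∷ u) (o ∷ t) = cong₂ _∷_ (outgoing-residue p o) (outgoings-fromBits u t)

corner-ext : {c d : Corner k} → positions c ≡ positions d → outgoings c ≡ outgoings d → c ≡ d
corner-ext {c = c} {d} p o = trans (sym (fromBits-positions-outgoings c))
  (trans (cong₂ fromBits p o) (fromBits-positions-outgoings d))

∃T-≡ : {P : A → Bool} {x y : ∃[ a ] T (P a)} → proj₁ x ≡ proj₁ y → x ≡ y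
∃T-≡ {x = _ , t} {_ , t′} refl = cong (_ ,_) (Bool.T-irrelevant t t′)

-- From tilings to outmaps

module FromTiling (S : Tiling k) where
  open Tiling S

  -- Otherwise the two tiles would have a unit cube in common.
  agree⇒≡ : ∀ {c d} → T (corner c) → T (corner d) →
    (∀ i → lookup (positions c) i ≢ lookup (positions d) i →
           lookup (outgoings c) i ≡ lookup (outgoings d) i) → c ≡ d
  agree⇒≡ {c} {d} tc td agree = decidable-stable (Vec.≡-dec Fin._≟_ c d) λ c≢d →
    proj₂ (proj₁ (meet x c d tc td c≢d (inside⇒tile c x∈c) (inside⇒tile d x∈d))) x∈c
    where
    common : ∀ i → ∃[ e ] SlabOf (lookup c i) e × SlabOf (lookup d i) e
    common i = common-slab (lookup c i) (lookup d i) agree′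
      where
      agree′ : position (lookup c i) ≢ position (lookup d i) → outgoing (lookup c i) ≡ outgoing (lookup d i)
      agree′ ne = subst₂ _≡_ (Vec.lookup-map i outgoing c) (Vec.lookup-map i outgoing d)
        (agree i (ne ∘ subst₂ _≡_ (Vec.lookup-map i position c) (Vec.lookup-map i position d)))

    x : Point _
    x = tabulate (centre ∘ proj₁ ∘ common)

    inside : ∀ i a → SlabOf a (proj₁ (common i)) → InOpenSide (lookup x i) a
    inside i a m = subst (λ y → InOpenSide y a)
      (sym (Vec.lookup∘tabulate (centre ∘ proj₁ ∘ common) i)) (centre-inside (proj₁ (common i)) a m)

    x∈c : x ∈Interior c
    x∈c i = inside i (lookup c i) (proj₁ (proj₂ (common i)))

    x∈d : x ∈Interior d
    x∈d i = inside i (lookup d i) (proj₂ (proj₂ (common i)))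

    inside⇒tile : ∀ c → x ∈Interior c → x ∈Tile c
    inside⇒tile c x∈c i = InOpenSide⇒InSide (lookup x i) {lookup c i} (x∈c i)

  positions-injective : ∀ {c d} → T (corner c) → T (corner d) → positions c ≡ positions d → c ≡ d
  positions-injective {c} {d} tc td eq = agree⇒≡ tc td λ i ne →
    contradiction (cong (λ v → lookup v i) eq) ne

  -- The 2ᵏ tiles have distinct positions, so by counting they exhaust the 2ᵏ vertices.
  tile-at : ∀ u → ∃[ (c , _) ] positions {k} c ≡ u
  tile-at = injective⇒surjective size (vertices k) (positions ∘ proj₁)
    λ {x} {y} eq → ∃T-≡ (positions-injective (proj₂ x) (proj₂ y) eq)

  outMapᵀ : OutMap k
  outMapᵀ u = outgoings (proj₁ (proj₁ (tile-at u)))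

  tile-graph : ∀ {c} → T (corner c) → outMapᵀ (positions c) ≡ outgoings c
  tile-graph {c} tc = let (d , td) , eq = tile-at (positions c) in
    cong outgoings (positions-injective td tc eq)

  graph-tile : ∀ {c} → outMapᵀ (positions c) ≡ outgoings c → T (corner c)
  graph-tile {c} eq = let (d , td) , eq′ = tile-at (positions c) in
    subst (T ∘ corner) (corner-ext eq′ eq) td

  outMapᵀ-separating : Separating outMapᵀ
  outMapᵀ-separating u v agree =
    let (c , tc) , c↦u = tile-at u
        (d , td) , d↦v = tile-at v
        c≡d = agree⇒≡ tc td λ i ne → agree i
          (ne ∘ subst₂ (λ v w → lookup v i ≡ lookup w i) (sym c↦u) (sym d↦v))
    in trans (sym c↦u) (trans (cong positions c≡d) d↦v)

-- From outmaps to tilings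

module FromOutMap (s : OutMap k) (sep : Separating s) where

  OnGraph : Corner k → Set
  OnGraph c = s (positions c) ≡ outgoings c

  onGraph? : ∀ c → Dec (OnGraph c)
  onGraph? c = Vec.≡-dec Bool._≟_ (s (positions c)) (outgoings c)

  graph : Vertex k → Corner k
  graph u = fromBits u (s u)

  onGraph : ∀ u → OnGraph (graph u)
  onGraph u = trans (cong s (positions-fromBits u (s u))) (sym (outgoings-fromBits u (s u)))

  cornerAt : Vertex k → ∃[ c ] T (isYes (onGraph? c))
  cornerAt u = graph u , fromWitness (onGraph u)

  vertices↔corners : Vertex k ↔ (∃[ c ] T (isYes (onGraph? c)))
  vertices↔corners = mk↔ₛ′ cornerAt (positions ∘ proj₁)
    (λ (c , t) → ∃T-≡ (corner-ext (positions-fromBits _ _)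
      (trans (outgoings-fromBits _ _) (toWitness {a? = onGraph? c} t))))
    (λ u → positions-fromBits u (s u))

  -- No coordinate of the two corners can differ in both bits, since the sides there share an
  -- interior point of one of them; separation then identifies the positions, and the graph the
  -- corners.
  overlap⇒≡ : ∀ (x : Point k) {c d} → OnGraph c → OnGraph d → x ∈Interior c → x ∈Tile d → c ≡ d
  overlap⇒≡ x {c} {d} gc gd x∈c x∈d =
    corner-ext same (trans (sym gc) (trans (cong s same) gd))
    where
    same : positions c ≡ positions d
    same = sep _ _ agree
      where
      agree : ∀ i → lookup (positions c) i ≢ lookup (positions d) i →
              lookup (s (positions c)) i ≡ lookup (s (positions d)) i
      agree i ne rewrite gc | gd | Vec.lookup-map i position c | Vec.lookup-map i position d
                       | Vec.lookup-map i outgoing c | Vec.lookup-map i outgoing d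
        = InOpenSide-InSide⇒agree (lookup x i) (lookup c i) (lookup d i) (x∈c i) (x∈d i) ne

  -- The unique fit of the slabs around `x` is the position of a tile containing their whole unit
  -- cube.
  covered : ∀ x → (∀ i → ∃ (InSlab (lookup x i))) → ∃[ c ] T (isYes (onGraph? c)) × x ∈Tile c
  covered x slabs = graph u , proj₂ (cornerAt u) , λ i →
      InSlab⇒InSide (lookup x i) (proj₁ (slabs i)) (lookup (graph u) i) (match i) (proj₂ (slabs i))
    where
    fit = separating⇒uniqueFit s sep (tabulate (proj₁ ∘ slabs))
    u = proj₁ fit

    match : ∀ i → SlabOf (lookup (graph u) i) (proj₁ (slabs i))
    match i rewrite Vec.lookup-zipWith residue i u (s u)
                  | position-residue (lookup u i) (lookup (s u) i)
                  | outgoing-residue (lookup u i) (lookup (s u) i)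
      = subst (λ e → Matches e (lookup u i) (lookup (s u) i))
          (Vec.lookup∘tabulate _ i) (proj₁ (proj₂ fit) i)

  tiling : Tiling k
  tiling = record
    { corner = isYes ∘ onGraph?
    ; size   = ↔-trans (vertices k) vertices↔corners
    ; covers = λ x → ¬¬-map (covered x)
        -- Double negation commutes with the finite conjunction over coordinates.
        (Fin.sequence (RawMonad.rawApplicative ¬¬-Monad) λ i → some-slab (lookup x i))
    ; meet   = λ x c d tc td c≢d x∈c x∈d →
        let gc = toWitness {a? = onGraph? c} tc
            gd = toWitness {a? = onGraph? d} td
        in (x∈c , λ x∈°c → c≢d (overlap⇒≡ x gc gd x∈°c x∈d))
         , (x∈d , λ x∈°d → c≢d (sym (overlap⇒≡ x gd gc x∈°d x∈c)))
    }

-- The bijection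

tiling⇒USO : Tiling k → USO k
tiling⇒USO S = separating⇒USO outMapᵀ outMapᵀ-separating
  where open FromTiling S

USO⇒tiling : USO k → Tiling k
USO⇒tiling O = FromOutMap.tiling (outMap (USO.orientation O)) (outMap-separating O)

isYes-≡ : ∀ {P : Set} (p? : Dec P) {b} → (P → T b) → (T b → P) → isYes p? ≡ b
isYes-≡ (yes _) {true}  _   _   = refl
isYes-≡ (yes p) {false} p⇒b _   = contradiction p p⇒b
isYes-≡ (no ¬p) {true}  _   b⇒p = contradiction (b⇒p _) ¬p
isYes-≡ (no _)  {false} _   _   = refl

isYes-arc?-cong : (s t : OutMap k) → (∀ u → s u ≡ t u) →
  ∀ u v → isYes (arc? s u v) ≡ isYes (arc? t u v)
isYes-arc?-cong s t s≗t u v = isYes-≡ (arc? s u v)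
  (λ (i , eq , out) → fromWitness (i , eq , trans (cong (λ w → lookup w i) (sym (s≗t u))) out))
  (λ b → let i , eq , out = toWitness {a? = arc? t u v} b
         in i , eq , trans (cong (λ w → lookup w i) (s≗t u)) out)

outMap-cong : (O O′ : Orientation k) →
  (∀ u v → Orientation.arc O u v ≡ Orientation.arc O′ u v) → ∀ u → outMap O u ≡ outMap O′ u
outMap-cong O O′ O≈O′ u = Vec.tabulate-cong λ i → O≈O′ u (flip u i)

-- Every vertex is the position of some tile, so the tiles pin down the map. Congruence and one
-- inverse law thereby reduce to a check on corners.
outMapᵀ-unique : (S : Tiling k) (t : OutMap k) →
  (∀ c → T (Tiling.corner S c) → t (positions c) ≡ outgoings c) → ∀ u → FromTiling.outMapᵀ S u ≡ t u
outMapᵀ-unique S t graph u =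
  let (c , tc) , eq = FromTiling.tile-at S u in trans (sym (graph c tc)) (cong t eq)

module _ (O : USO k) where
  private
    s = outMap (USO.orientation O)

  onGraph? : ∀ c → Dec (s (positions c) ≡ outgoings c)
  onGraph? = FromOutMap.onGraph? s (outMap-separating O)

  USO⇒tiling-corner : ∀ c {b} → (s (positions c) ≡ outgoings c → T b) →
    (T b → s (positions c) ≡ outgoings c) → Tiling.corner (USO⇒tiling O) c ≡ b
  USO⇒tiling-corner c = isYes-≡ (onGraph? c)

module _ {k : ℕ} where
  open Setoid (Tilings k) using () renaming (_≈_ to _≈ᵀ_)
  open Setoid (USOs k) using () renaming (_≈_ to _≈ᵁ_)

  tiling⇒USO-cong : ∀ S S′ → S ≈ᵀ S′ → tiling⇒USO S ≈ᵁ tiling⇒USO S′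
  tiling⇒USO-cong S S′ S≈S′ = isYes-arc?-cong (FromTiling.outMapᵀ S) (FromTiling.outMapᵀ S′)
    (outMapᵀ-unique S (FromTiling.outMapᵀ S′) λ c tc →
      FromTiling.tile-graph S′ {c} (subst T (S≈S′ c) tc))

  USO⇒tiling-cong : ∀ O O′ → O ≈ᵁ O′ → USO⇒tiling O ≈ᵀ USO⇒tiling O′
  USO⇒tiling-cong O O′ O≈O′ c = USO⇒tiling-corner O c
    (λ g → fromWitness {a? = onGraph? O′ c} (trans (sym eq) g))
    (λ b → trans eq (toWitness {a? = onGraph? O′ c} b))
    where
    eq = outMap-cong (USO.orientation O) (USO.orientation O′) O≈O′ (positions c)

  tiling⇒USO-inverse : ∀ O S → S ≈ᵀ USO⇒tiling O → tiling⇒USO S ≈ᵁ O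
  tiling⇒USO-inverse O S S≈ u v = trans
    (isYes-arc?-cong (FromTiling.outMapᵀ S) (outMap (USO.orientation O))
      (outMapᵀ-unique S (outMap (USO.orientation O)) λ c tc →
        toWitness {a? = onGraph? O c} (subst T (S≈ c) tc)) u v)
    (sym (arc≡isYes-arc? (USO.orientation O) u v))

  USO⇒tiling-inverse : ∀ S O → O ≈ᵁ tiling⇒USO S → USO⇒tiling O ≈ᵀ S
  USO⇒tiling-inverse S O O≈ c = USO⇒tiling-corner O c
    (λ g → graph-tile {c} (trans (sym eq) g))
    (λ tc → trans eq (tile-graph {c} tc))
    where
    open FromTiling S
    eq : outMap (USO.orientation O) (positions c) ≡ outMapᵀ (positions c)
    eq = trans (outMap-cong (USO.orientation O) (USO.orientation (tiling⇒USO S)) O≈ (positions c))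
               (outMap-orientation outMapᵀ outMapᵀ-separating (positions c))

lemma13 : (k : ℕ) → k ≥ 1 → Bijection (Tilings k) (USOs k)
lemma13 k _ = Inverse⇒Bijection record
  { to        = tiling⇒USO
  ; from      = USO⇒tiling
  ; to-cong   = λ {S} {S′} → tiling⇒USO-cong S S′
  ; from-cong = λ {O} {O′} → USO⇒tiling-cong O O′
  ; inverse   = (λ {O} {S} → tiling⇒USO-inverse O S) , λ {S} {O} → USO⇒tiling-inverse S O
  }
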